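{- Let $F$ be a labeled plane figure over a finite alphabet $\Sigma$, and let $A$ and $B$ be nonempty rectangular arrays over $\Sigma$. Suppose $F$ has two different tilings $U$ and $V$ by the set $\{A, B\}$. Then both $A$ and $B$ are powers of a third array $C$, i.e., there exist a nonempty array $C$ and positive integers $p_1,q_1,p_2,q_2$ with $A = C^{p_1\times q_1}$ and $B = C^{p_2\times q_2}$.
   Context: A labeled plane figure is a map from a finite subset $D \subseteq \mathbb{Z}\times\mathbb{Z}$ (its cells) to $\Sigma$; it need not be connected or convex. An $m\times n$ array $M$ (entries $M[i,j]$, $0\le i<m$, $0\le j<n$) placed at translate $(a,b)\in\mathbb{Z}^2$ occupies the cells $(a+i,b+j)$ carrying labels $M[i,j]$ (no rotations or reflections). For a finite set $S$ of rectangular arrays, a tiling of $F$ by $S$ is a finite collection of translates of arrays from $S$ such that the occupied cells of distinct placed tiles are pairwise disjoint, their union is exactly $D$, and each cell of $D$ is covered by an entry equal to its label. Two tilings are different if they are different as collections of placed (translated) tiles. For $A\in\Sigma^{m\times n}$ and positive integers $p,q$, $A^{p\times q}$ is the $pm \times qn$ array $B$ with $B[i,j] = A[i \bmod m, j \bmod n]$. -}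

module Defs where

open import Data.Nat using (ℕ; _*_; NonZero)
open import Data.Nat.DivMod using (_mod_)
open import Data.Integer as ℤ using (ℤ; +_)
open import Data.Fin using (Fin; toℕ)
open import Data.Vec using (Vec; lookup; tabulate)
open import Data.List using (List; length)
open import Data.List.Membership.Propositional using (_∈_)
open import Data.List.Relation.Unary.All using (All)
open import Data.Product using (Σ; ∃; ∃-syntax; _×_; _,_)
open import Data.Sum using (_⊎_)
open import Relation.Binary.PropositionalEquality using (_≡_)
open import Relation.Nullary using (¬_)
open import Function.Bundles using (_↔_; _⇔_)

Finite : Set → Set
Finite Sig = ∃[ k ] (Sig ↔ Fin k)

Cell : Set
Cell = ℤ × ℤ

record Array (Sig : Set) : Set where
  constructor mkArray
  field
    rows    : ℕ
    cols    : ℕ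
    entries : Vec (Vec Sig cols) rows
open Array public

entry : {Sig : Set} (A : Array Sig) → Fin (rows A) → Fin (cols A) → Sig
entry A i j = lookup (lookup (entries A) i) j

Nonempty : {Sig : Set} → Array Sig → Set
Nonempty A = NonZero (rows A) × NonZero (cols A)

pow : {Sig : Set} (C : Array Sig) → Nonempty C → ℕ → ℕ → Array Sig
pow C (nzr , nzc) p q =
  mkArray (p * rows C) (q * cols C)
    (tabulate λ i → tabulate λ j →
      entry C ((_mod_ (toℕ i) (rows C)) {{nzr}}) ((_mod_ (toℕ j) (cols C)) {{nzc}}))

-- A labeled plane figure: finite domain D (given as a list of cells; only
-- membership matters) and its labeling (values outside D are irrelevant).
record Figure (Sig : Set) : Set where
  constructor mkFigure
  field
    dom   : List Cell
    label : Cell → Sig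
open Figure public

InDom : {Sig : Set} → Figure Sig → Cell → Set
InDom F c = c ∈ dom F

PlacedTile : Set → Set
PlacedTile Sig = Array Sig × Cell

OccAt : {Sig : Set} (t : PlacedTile Sig) → Cell →
        (Σ (Fin (rows (Data.Product.proj₁ t))) λ _ → Fin (cols (Data.Product.proj₁ t))) → Set
OccAt (A , (a , b)) c (i , j) = c ≡ (a ℤ.+ + toℕ i , b ℤ.+ + toℕ j)

Occupies : {Sig : Set} → PlacedTile Sig → Cell → Set
Occupies t c = ∃ λ ij → OccAt t c ij

record IsTiling {Sig : Set} (F : Figure Sig) (S : Array Sig → Set)
                (U : List (PlacedTile Sig)) : Set where
  field
    fromS    : All (λ t → S (Data.Product.proj₁ t)) U
    disjoint : (k l : Fin (length U)) → ¬ (k ≡ l) → (c : Cell) →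
               Occupies (Data.List.lookup U k) c →
               ¬ Occupies (Data.List.lookup U l) c
    inside   : (t : PlacedTile Sig) → t ∈ U → (c : Cell) → Occupies t c → InDom F c
    covers   : (c : Cell) → InDom F c → ∃[ t ] (t ∈ U × Occupies t c)
    labels   : (t : PlacedTile Sig) → t ∈ U → (c : Cell) →
               (ij : Σ (Fin (rows (Data.Product.proj₁ t))) λ _ → Fin (cols (Data.Product.proj₁ t))) →
               OccAt t c ij →
               label F c ≡ entry (Data.Product.proj₁ t) (Data.Product.proj₁ ij) (Data.Product.proj₂ ij)

SameCollection : {Sig : Set} → List (PlacedTile Sig) → List (PlacedTile Sig) → Set
SameCollection U V = ∀ t → (t ∈ U) ⇔ (t ∈ V)

Pair : {Sig : Set} → Array Sig → Array Sig → Array Sig → Set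
Pair A B T = T ≡ A ⊎ T ≡ B

{-# OPTIONS --safe #-}
module Submission where

-- Encode the letters as integers, so that a function on the cells becomes a formal series in
-- X, Y. If P and Q are the Laurent polynomials of the positions of A and of B, each position
-- counted +1 in U and −1 in V, then that U and V tile the same figure says P·A + Q·B = 0, both
-- for the letter weights and for the constant weight 1. With a, b the periodic extensions of A, B
-- to the quadrant, A = (1−X^m)(1−Y^n)·a for A of size m × n, and likewise for B; so with
-- R = P(1−X^m)(1−Y^n) and S the analogous multiple of Q we get R·a + S·b = 0, and, 1/((1−X)(1−Y))
-- being the extension of both constant arrays, R + S = 0. Hence R·(a − b) = 0. Series supported on
-- the quadrant have no torsion over Laurent polynomials (look at lexicographically least
-- exponents), so either R = 0, which gives P = Q = 0 and U = V, or a = b. In the latter case the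
-- common extension has the gcds of the side lengths as periods.

open import Defs
open import Data.Empty using (⊥-elim)
open import Data.Fin using (Fin; zero; suc; toℕ; fromℕ<)
import Data.Fin.Properties as Fin
open import Data.Integer using (ℤ; +_; -[1+_]; 0ℤ; 1ℤ; -1ℤ; _+_; _*_; _-_; -_; _<_; -<+; +<+; ∣_∣)
import Data.Integer.Properties as ℤ
open import Data.Integer.Tactic.RingSolver using (solve-∀)
open import Data.List using (List; []; _∷_; _++_; map; length; lookup)
open import Data.List.Membership.Propositional using (_∈_)
open import Data.List.Relation.Unary.All as All using (All; []; _∷_)
open import Data.List.Relation.Unary.Any as Any using (here; there)
open import Data.List.Relation.Unary.Any.Properties using (lookup-index)
open import Data.Nat as ℕ using (ℕ; zero; suc; s≤s; z≤n; NonZero; _≤_)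
open import Data.Nat.Divisibility using (divides)
open import Data.Nat.DivMod using (_mod_; _%_; _/_; m%n<n; m<n⇒m%n≡m; [m+n]%n≡m%n; m≡m%n+[m/n]*n)
open import Data.Nat.GCD using (gcd; gcd-GCD; gcd[m,n]∣m; gcd[m,n]∣n; gcd[m,n]≢0; module Bézout)
import Data.Nat.Properties as ℕ
open import Data.Product using (Σ; ∃; ∃-syntax; _×_; _,_; proj₁; proj₂)
open import Data.Product.Properties using (≡-dec)
open import Data.Product.Relation.Binary.Lex.Strict using (×-Lex; ×-compare; ×-transitive)
open import Data.Sum using (_⊎_; inj₁; inj₂; [_,_]′)
import Data.Vec as Vec
import Data.Vec.Properties as Vec
open import Function using (_∘_; Inverse; mk⇔)
open import Relation.Binary.Definitions using (tri<; tri≈; tri>)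
open import Relation.Binary.PropositionalEquality using (_≡_; refl; sym; trans; cong; cong₂; subst; resp₂; isEquivalence; module ≡-Reasoning)
open import Relation.Nullary using (¬_; Dec; yes; no; contradiction)

+-congˡ : ∀ x {y z : ℤ} → y ≡ z → x + y ≡ x + z
+-congˡ x = cong (λ y → x + y)

x+y-y≡x : ∀ x y → (x + y) - y ≡ x
x+y-y≡x = solve-∀

x+y-x≡y : ∀ x y → (x + y) - x ≡ y
x+y-x≡y = solve-∀

x-y+y≡x : ∀ x y → (x - y) + y ≡ x
x-y+y≡x = solve-∀

-- Laurent polynomials acting on functions of the cells

infixl 6 _⊹_ _⊖_

_⊹_ _⊖_ : Cell → Cell → Cell
(x , y) ⊹ (a , b) = x + a , y + b
(x , y) ⊖ (a , b) = x - a , y - b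

c⊹d⊖d≡c : ∀ c d → (c ⊹ d) ⊖ d ≡ c
c⊹d⊖d≡c (x , y) (a , b) = cong₂ _,_ (x+y-y≡x x a) (x+y-y≡x y b)

⊖-⊹ : ∀ c d e → c ⊖ d ⊖ e ≡ c ⊖ (d ⊹ e)
⊖-⊹ (x , y) (a , b) (a′ , b′) = cong₂ _,_ (lem x a a′) (lem y b b′)
  where
  lem : ∀ x a b → (x - a) - b ≡ x - (a + b)
  lem = solve-∀

infix 4 _≺_

_≺_ : Cell → Cell → Set
_≺_ = ×-Lex _≡_ _<_ _<_

≺-trans : ∀ {c d e} → c ≺ d → d ≺ e → c ≺ e
≺-trans {c} {d} {e} =
  ×-transitive {_<₂_ = _<_} isEquivalence (resp₂ _<_) ℤ.<-trans ℤ.<-trans {c} {d} {e}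

-- Meant for a polynomial read at `c ⊹ d`, with `d` its least exponent: every other term then looks
-- up the series strictly before `c`.
d≺e⇒c⊹d⊖e≺c : ∀ c {d e} → d ≺ e → (c ⊹ d) ⊖ e ≺ c
d≺e⇒c⊹d⊖e≺c (x , y) {a , b} {a′ , b′} = λ where
    (inj₁ a<a′)          → inj₁ (shrink x a<a′)
    (inj₂ (refl , b<b′)) → inj₂ (x+y-y≡x x a , shrink y b<b′)
  where
  shrink : ∀ x {a b} → a < b → (x + a) - b < x
  shrink x {a} {b} a<b =
    subst ((x + a) - b <_) (x+y-y≡x x b) (ℤ.+-monoˡ-< (- b) (ℤ.+-monoʳ-< x a<b))

-- A Laurent polynomial in two variables, as a list of terms (coefficient , exponent).
Poly : Set
Poly = List (ℤ × Cell)

-- Multiplication of the formal series Σ g(c) X^c by a polynomial.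
act : Poly → (Cell → ℤ) → Cell → ℤ
act []            g c = 0ℤ
act ((s , d) ∷ P) g c = s * g (c ⊖ d) + act P g c

mulTerm : ℤ × Cell → Poly → Poly
mulTerm (s , d) = map λ (t , e) → s * t , d ⊹ e

mul : Poly → Poly → Poly
mul []      Q = []
mul (t ∷ P) Q = mulTerm t Q ++ mul P Q

act-cong : ∀ P {g h} → (∀ c → g c ≡ h c) → ∀ c → act P g c ≡ act P h c
act-cong []            g≡h c = refl
act-cong ((s , d) ∷ P) g≡h c = cong₂ _+_ (cong (s *_) (g≡h _)) (act-cong P g≡h c)

act-++ : ∀ P Q g c → act (P ++ Q) g c ≡ act P g c + act Q g c
act-++ []            Q g c = sym (ℤ.+-identityˡ _)
act-++ ((s , d) ∷ P) Q g c =
  trans (+-congˡ (s * g (c ⊖ d)) (act-++ P Q g c)) (sym (ℤ.+-assoc (s * g (c ⊖ d)) _ _))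

act-- : ∀ P g h c → act P (λ e → g e - h e) c ≡ act P g c - act P h c
act-- []            g h c = refl
act-- ((s , d) ∷ P) g h c =
  trans (+-congˡ (s * (g (c ⊖ d) - h (c ⊖ d))) (act-- P g h c)) (lem s (g (c ⊖ d)) (h (c ⊖ d)) _ _)
  where
  lem : ∀ s a b p q → s * (a - b) + (p - q) ≡ (s * a + p) - (s * b + q)
  lem = solve-∀

act-mulTerm : ∀ s d Q g c → act (mulTerm (s , d) Q) g c ≡ s * act Q g (c ⊖ d)
act-mulTerm s d []            g c = sym (ℤ.*-zeroʳ s)
act-mulTerm s d ((t , e) ∷ Q) g c =
  trans (cong₂ _+_ (cong (λ z → s * t * g z) (sym (⊖-⊹ c d e))) (act-mulTerm s d Q g c))
        (lem s t (g (c ⊖ d ⊖ e)) _)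
  where
  lem : ∀ s t a p → s * t * a + s * p ≡ s * (t * a + p)
  lem = solve-∀

act-mul : ∀ P Q g c → act (mul P Q) g c ≡ act P (act Q g) c
act-mul []            Q g c = refl
act-mul ((s , d) ∷ P) Q g c =
  trans (act-++ (mulTerm (s , d) Q) (mul P Q) g c)
        (cong₂ _+_ (act-mulTerm s d Q g c) (act-mul P Q g c))

-- A list of terms may repeat exponents or carry zero coefficients, so the zero polynomial is
-- recognised by its action and not by the shape of the list.
Null : Poly → Set
Null P = ∀ g c → act P g c ≡ 0ℤ

-- Absence of torsion for series supported on the quadrant

record InQuadrant (g : Cell → ℤ) : Set where
  field
    left  : ∀ {x} y → x < 0ℤ → g (x , y) ≡ 0ℤ
    below : ∀ x {y} → y < 0ℤ → g (x , y) ≡ 0ℤ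
open InQuadrant

-- The support condition is essential: 1 - X annihilates the series that is constant on all cells.
Cancellable : Poly → Set
Cancellable P = ∀ g → InQuadrant g → (∀ c → act P g c ≡ 0ℤ) → ∀ c → g c ≡ 0ℤ

<-suc⁻ : ∀ {x n} → x < + suc n → x < + n ⊎ x ≡ + n
<-suc⁻ {+ k} (+<+ (s≤s k≤n)) with ℕ.m≤n⇒m<n∨m≡n k≤n
... | inj₁ k<n  = inj₁ (+<+ k<n)
... | inj₂ refl = inj₂ refl
<-suc⁻ { -[1+ _ ]} -<+ = inj₁ -<+

-- The order `≺` is not well-founded on all cells, but `g` vanishes off the quadrant and `≺` is
-- well-founded there. The outer recursion bounds the column, the inner one the height within a
-- column.
≺-induction : ∀ g → InQuadrant g →
              (∀ c → (∀ e → e ≺ c → g e ≡ 0ℤ) → g c ≡ 0ℤ) → ∀ c → g c ≡ 0ℤ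
≺-induction g supp hyp (x , y) = columns (suc ∣ x ∣) y (<1+∣ x ∣)
  where
  <1+∣_∣ : ∀ x → x < + suc ∣ x ∣
  <1+∣ + n ∣      = +<+ ℕ.≤-refl
  <1+∣ -[1+ n ] ∣ = -<+

  columns : ∀ n {x} y → x < + n → g (x , y) ≡ 0ℤ
  columns zero    y x<0 = left supp y x<0
  columns (suc n) y x<1+n with <-suc⁻ x<1+n
  ... | inj₁ x<n  = columns n y x<n
  ... | inj₂ refl = cells (suc ∣ y ∣) (<1+∣ y ∣)
    where
    cells : ∀ k {y} → y < + k → g (+ n , y) ≡ 0ℤ
    cells zero    y<0 = below supp (+ n) y<0
    cells (suc k) y<1+k with <-suc⁻ y<1+k
    ... | inj₁ y<k  = cells k y<k
    ... | inj₂ refl = hyp (+ n , + k) λ where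
      (_ , y′) (inj₁ x<n)          → columns n y′ x<n
      _        (inj₂ (refl , y<k)) → cells k y<k

-- Only the least exponent is isolated; the terms of `rest` may still repeat or cancel each other.
-- The field `shorter` is there for the recursion in `null⊎leading`.
record Leading (P : Poly) : Set where
  field
    coeff    : ℤ
    exponent : Cell
    rest     : Poly
    coeff≢0  : ¬ coeff ≡ 0ℤ
    minimal  : All (λ t → exponent ≺ proj₂ t) rest
    shorter  : length rest ℕ.< length P
    same     : ∀ g c → act P g c ≡ act ((coeff , exponent) ∷ rest) g c

-- At `c ⊹ exponent` the leading term contributes `coeff * g c`, and all others read `g` at cells
-- before `c`, where it is zero by induction. The integers have no zero divisors, so `g c` is zero.
leading⇒cancellable : ∀ {P} → Leading P → Cancellable P
leading⇒cancellable {P} L g supp Pg≡0 = ≺-induction g supp λ c below-c →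
  let
    open ≡-Reasoning
    eq : coeff * g c ≡ 0ℤ
    eq = begin
      coeff * g c
        ≡⟨ cong (λ e → coeff * g e) (sym (c⊹d⊖d≡c c exponent)) ⟩
      coeff * g (c ⊹ exponent ⊖ exponent)
        ≡⟨ sym (ℤ.+-identityʳ _) ⟩
      coeff * g (c ⊹ exponent ⊖ exponent) + 0ℤ
        ≡⟨ +-congˡ (coeff * g (c ⊹ exponent ⊖ exponent)) (sym (vanish c below-c rest minimal)) ⟩
      act ((coeff , exponent) ∷ rest) g (c ⊹ exponent)
        ≡⟨ sym (same g (c ⊹ exponent)) ⟩
      act P g (c ⊹ exponent)
        ≡⟨ Pg≡0 (c ⊹ exponent) ⟩
      0ℤ ∎
  in [ (λ s≡0 → contradiction s≡0 coeff≢0) , (λ gc≡0 → gc≡0) ]′ (ℤ.i*j≡0⇒i≡0∨j≡0 coeff eq)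
  where
  open Leading L
  vanish : ∀ c → (∀ e → e ≺ c → g e ≡ 0ℤ) → ∀ R → All (λ t → exponent ≺ proj₂ t) R →
           act R g (c ⊹ exponent) ≡ 0ℤ
  vanish c below-c []            []          = refl
  vanish c below-c ((s , d) ∷ R) (e≺d ∷ all) =
    trans (cong₂ _+_ (cong (s *_) (below-c _ (d≺e⇒c⊹d⊖e≺c c e≺d))) (vanish c below-c R all))
          (trans (ℤ.+-identityʳ _) (ℤ.*-zeroʳ s))

-- The bound n on the length makes the recursion on the rest of a cancelled pair structural.
null⊎leading : ∀ n P → length P ℕ.≤ n → Null P ⊎ Leading P
null⊎leading _ [] _ = inj₁ λ _ _ → refl
null⊎leading (suc n) ((s , d) ∷ P) (s≤s ∣P∣≤n) with s ℤ.≟ 0ℤ | null⊎leading n P ∣P∣≤n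
... | yes refl | inj₁ null = inj₁ λ g c → trans (ℤ.+-identityˡ _) (null g c)
... | yes refl | inj₂ L    = inj₂ record
  { Leading L
  ; shorter = ℕ.m≤n⇒m≤1+n (Leading.shorter L)
  ; same    = λ g c → trans (ℤ.+-identityˡ _) (Leading.same L g c)
  }
... | no s≢0 | inj₁ null = inj₂ record
  { coeff = s ; exponent = d ; rest = [] ; coeff≢0 = s≢0 ; minimal = []
  ; shorter = s≤s z≤n
  ; same = λ g c → +-congˡ (s * g (c ⊖ d)) (null g c)
  }
... | no s≢0 | inj₂ L with ×-compare sym ℤ.<-cmp ℤ.<-cmp d (Leading.exponent L)
...   | tri< d≺e _ _ = inj₂ record
  { coeff = s ; exponent = d ; rest = (coeff , exponent) ∷ rest ; coeff≢0 = s≢0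
  ; minimal = d≺e ∷ All.map (λ {t} → ≺-trans {d} {exponent} {proj₂ t} d≺e) minimal
  ; shorter = s≤s shorter
  ; same = λ g c → +-congˡ (s * g (c ⊖ d)) (same g c)
  }
  where open Leading L
...   | tri> _ _ e≺d = inj₂ record
  { coeff = coeff ; exponent = exponent ; rest = (s , d) ∷ rest ; coeff≢0 = coeff≢0
  ; minimal = e≺d ∷ minimal
  ; shorter = s≤s shorter
  ; same = λ g c → trans (+-congˡ (s * g (c ⊖ d)) (same g c))
                         (swap (s * g (c ⊖ d)) (coeff * g (c ⊖ exponent)) _)
  }
  where
  open Leading L
  swap : ∀ a b p → a + (b + p) ≡ b + (a + p)
  swap = solve-∀
-- Equal exponents: the coefficients add up. If the sum is zero, only `rest` survives, and its own
-- least exponent has to be sought afresh.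
...   | tri≈ _ (refl , refl) _ = merge (s + coeff ℤ.≟ 0ℤ)
  where
  open Leading L
  merged : ∀ g c → s * g (c ⊖ d) + act P g c ≡ (s + coeff) * g (c ⊖ d) + act rest g c
  merged g c = trans (+-congˡ (s * g (c ⊖ d)) (same g c)) (lem s coeff (g (c ⊖ d)) _)
    where
    lem : ∀ s t a p → s * a + (t * a + p) ≡ (s + t) * a + p
    lem = solve-∀
  dropped : s + coeff ≡ 0ℤ → ∀ g c → s * g (c ⊖ d) + act P g c ≡ act rest g c
  dropped s+t≡0 g c = trans (merged g c)
    (trans (cong (λ z → z * g (c ⊖ d) + act rest g c) s+t≡0) (ℤ.+-identityˡ _))
  merge : Dec (s + coeff ≡ 0ℤ) → Null ((s , d) ∷ P) ⊎ Leading ((s , d) ∷ P)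
  merge (no s+t≢0) = inj₂ record
    { coeff = s + coeff ; exponent = d ; rest = rest ; coeff≢0 = s+t≢0
    ; minimal = minimal ; shorter = ℕ.m≤n⇒m≤1+n shorter ; same = merged }
  merge (yes s+t≡0) with null⊎leading n rest (ℕ.≤-trans (ℕ.<⇒≤ shorter) ∣P∣≤n)
  ... | inj₁ null = inj₁ λ g c → trans (dropped s+t≡0 g c) (null g c)
  ... | inj₂ L′ = inj₂ record
    { Leading L′
    ; shorter = ℕ.<-trans (Leading.shorter L′) (ℕ.m≤n⇒m≤1+n shorter)
    ; same = λ g c → trans (dropped s+t≡0 g c) (Leading.same L′ g c)
    }

null⊎cancellable : ∀ P → Null P ⊎ Cancellable P
null⊎cancellable P with null⊎leading (length P) P ℕ.≤-refl
... | inj₁ null = inj₁ null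
... | inj₂ L    = inj₂ (leading⇒cancellable L)

-- Periodic functions on the quadrant and their restrictions to rectangles

step : ℤ → ℤ
step (+ _)    = 1ℤ
step -[1+ _ ] = 0ℤ

-- The indicator of 0 ≤ x < m, written as 1 - X^m applied to `step`, the form in which it arises in
-- `corners-quadrant`.
interval : ℕ → ℤ → ℤ
interval m x = step x - step (x - + m)

step-neg : ∀ {x} → x < 0ℤ → step x ≡ 0ℤ
step-neg -<+ = refl
step-neg (+<+ ())

interval-cases : ∀ m x →
  (interval m x ≡ 1ℤ × ∃[ i ] x ≡ + toℕ {m} i) ⊎
  (interval m x ≡ 0ℤ × ¬ (∃[ i ] x ≡ + toℕ {m} i))
interval-cases zero    -[1+ k ] = inj₂ (refl , λ ())
interval-cases (suc m) -[1+ k ] = inj₂ (refl , λ ())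
interval-cases m (+ k) with k ℕ.<? m
... | no k≮m = inj₂ (cong (λ z → 1ℤ - step z)
                       (trans (ℤ.[+m]-[+n]≡m⊖n k m) (ℤ.⊖-≥ (ℕ.≮⇒≥ k≮m))) ,
                     λ { (i , refl) → k≮m (Fin.toℕ<n i) })
... | yes k<m with + k - + m in eq
...   | -[1+ _ ] = inj₁ (refl , fromℕ< k<m , cong +_ (sym (Fin.toℕ-fromℕ< k<m)))
...   | + j = contradiction k<m (ℕ.≤⇒≯ (ℕ.≤-trans (ℕ.m≤n+m m j) (ℕ.≤-reflexive (sym k≡j+m))))
  where
  k≡j+m : k ≡ j ℕ.+ m
  k≡j+m = ℤ.+-injective (trans (sym (x-y+y≡x (+ k) (+ m))) (cong (_+ + m) eq))

-- Where `x - + m` is negative its absolute value is meaningless, but the factor `step` makes both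
-- sides zero; elsewhere periodicity applies.
step-periodic : ∀ (f : ℕ → ℤ) m → (∀ i → f (i ℕ.+ m) ≡ f i) →
                ∀ x → step (x - + m) * f ∣ x - + m ∣ ≡ step (x - + m) * f ∣ x ∣
step-periodic f m per x with x - + m in eq
... | -[1+ _ ] = refl
... | + j = cong (1ℤ *_) (trans (sym (per j)) (cong (f ∘ ∣_∣) (sym x≡j+m)))
  where
  x≡j+m : x ≡ + (j ℕ.+ m)
  x≡j+m = trans (sym (x-y+y≡x x (+ m))) (cong (_+ + m) eq)

-- (1 − X^m)(1 − Y^n)
corners : ℕ → ℕ → Poly
corners m n =
  (1ℤ , + 0 , + 0) ∷ (-1ℤ , + m , + 0) ∷ (-1ℤ , + 0 , + n) ∷ (1ℤ , + m , + n) ∷ []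

-- Here `∣_∣` merely converts coordinates to naturals; what it yields at negative ones is multiplied
-- by zero.
quadrant : (ℕ → ℕ → ℤ) → Cell → ℤ
quadrant f (x , y) = step x * step y * f ∣ x ∣ ∣ y ∣

rectangle : ℕ → ℕ → (ℕ → ℕ → ℤ) → Cell → ℤ
rectangle m n f (x , y) = interval m x * interval n y * f ∣ x ∣ ∣ y ∣

quadrant-InQuadrant : ∀ f → InQuadrant (quadrant f)
quadrant-InQuadrant f = record
  { left  = λ {x} y x<0 → cong (λ s → s * step y * f ∣ x ∣ ∣ y ∣) (step-neg x<0)
  ; below = λ x {y} y<0 → trans (cong (λ s → step x * s * f ∣ x ∣ ∣ y ∣) (step-neg y<0))
                                 (cong (_* f ∣ x ∣ ∣ y ∣) (ℤ.*-zeroʳ (step x)))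
  }

interval-neg : ∀ m {x} → x < 0ℤ → interval m x ≡ 0ℤ
interval-neg zero    -<+ = refl
interval-neg (suc _) -<+ = refl
interval-neg _ (+<+ ())

rectangle-InQuadrant : ∀ m n f → InQuadrant (rectangle m n f)
rectangle-InQuadrant m n f = record
  { left  = λ {x} y x<0 → cong (λ s → s * interval n y * f ∣ x ∣ ∣ y ∣) (interval-neg m x<0)
  ; below = λ x {y} y<0 → trans (cong (λ s → interval m x * s * f ∣ x ∣ ∣ y ∣) (interval-neg n y<0))
                                 (cong (_* f ∣ x ∣ ∣ y ∣) (ℤ.*-zeroʳ (interval m x)))
  }

difference-InQuadrant : ∀ {g h} → InQuadrant g → InQuadrant h → InQuadrant (λ e → g e - h e)
difference-InQuadrant p q = record
  { left  = λ y x<0 → cong₂ _-_ (InQuadrant.left p y x<0) (InQuadrant.left q y x<0)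
  ; below = λ x y<0 → cong₂ _-_ (InQuadrant.below p x y<0) (InQuadrant.below q x y<0)
  }

-- Shifting by a period changes the support but not the values, so the four shifted copies share the
-- factor `f ∣ x ∣ ∣ y ∣`, and the steps combine to a product of two intervals.
corners-quadrant : ∀ m n f → (∀ i j → f (i ℕ.+ m) j ≡ f i j) → (∀ i j → f i (j ℕ.+ n) ≡ f i j) →
                   ∀ c → act (corners m n) (quadrant f) c ≡ rectangle m n f c
corners-quadrant m n f perˣ perʸ (x , y)
  rewrite ℤ.+-identityʳ x | ℤ.+-identityʳ y = begin
    1ℤ * (a * b * F) + (-1ℤ * (a′ * b * F₁) + (-1ℤ * (a * b′ * F₂) + (1ℤ * (a′ * b′ * F₃) + 0ℤ)))
      ≡⟨ regroup a b a′ b′ F F₁ F₂ F₃ ⟩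
    a * b * F - b * (a′ * F₁) - a * (b′ * F₂) + b′ * (a′ * F₃)
      -- Undoing the horizontal shift turns `F₁` into `F` and `F₃` into `F₂`; the vertical shift
      -- then remains in `F₂` alone.
      ≡⟨ cong₂ (λ u v → a * b * F - b * u - a * (b′ * F₂) + b′ * v)
           (step-periodic (λ i → f i ∣ y ∣) m (λ i → perˣ i _) x)
           (step-periodic (λ i → f i ∣ y - + n ∣) m (λ i → perˣ i _) x) ⟩
    a * b * F - b * (a′ * F) - a * (b′ * F₂) + b′ * (a′ * F₂)
      ≡⟨ regroup₂ a b a′ b′ F F₂ ⟩
    a * b * F - b * (a′ * F) - (a - a′) * (b′ * F₂)
      ≡⟨ cong (λ u → a * b * F - b * (a′ * F) - (a - a′) * u)
           (step-periodic (f ∣ x ∣) n (perʸ ∣ x ∣) y) ⟩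
    a * b * F - b * (a′ * F) - (a - a′) * (b′ * F)
      ≡⟨ regroup₃ a b a′ b′ F ⟩
    (a - a′) * (b - b′) * F ∎
  where
  open ≡-Reasoning
  a b a′ b′ F F₁ F₂ F₃ : ℤ
  a  = step x
  b  = step y
  a′ = step (x - + m)
  b′ = step (y - + n)
  F  = f ∣ x ∣ ∣ y ∣
  F₁ = f ∣ x - + m ∣ ∣ y ∣
  F₂ = f ∣ x ∣ ∣ y - + n ∣
  F₃ = f ∣ x - + m ∣ ∣ y - + n ∣
  regroup : ∀ a b a′ b′ F F₁ F₂ F₃ →
    1ℤ * (a * b * F) + (-1ℤ * (a′ * b * F₁) + (-1ℤ * (a * b′ * F₂) + (1ℤ * (a′ * b′ * F₃) + 0ℤ)))
    ≡ a * b * F - b * (a′ * F₁) - a * (b′ * F₂) + b′ * (a′ * F₃)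
  regroup = solve-∀
  regroup₂ : ∀ a b a′ b′ F F₂ →
    a * b * F - b * (a′ * F) - a * (b′ * F₂) + b′ * (a′ * F₂)
    ≡ a * b * F - b * (a′ * F) - (a - a′) * (b′ * F₂)
  regroup₂ = solve-∀
  regroup₃ : ∀ a b a′ b′ F →
    a * b * F - b * (a′ * F) - (a - a′) * (b′ * F) ≡ (a - a′) * (b - b′) * F
  regroup₃ = solve-∀

-- Periodic extensions of arrays and the series of a tile

mod-+ : ∀ i n .{{_ : NonZero n}} → (i ℕ.+ n) mod n ≡ i mod n
mod-+ i n = Fin.fromℕ<-cong _ _ ([m+n]%n≡m%n i n) _ _

mod-toℕ : ∀ {n} .{{_ : NonZero n}} (i : Fin n) → toℕ i mod n ≡ i
mod-toℕ {n} i = Fin.toℕ-injective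
  (trans (Fin.toℕ-fromℕ< (m%n<n (toℕ i) n)) (m<n⇒m%n≡m (Fin.toℕ<n i)))

module _ {Sig : Set} where

  periodic : (T : Array Sig) → Nonempty T → ℕ → ℕ → Sig
  periodic T (nzr , nzc) i j = entry T ((i mod rows T) {{nzr}}) ((j mod cols T) {{nzc}})

  periodic-row : ∀ T ne i j → periodic T ne (i ℕ.+ rows T) j ≡ periodic T ne i j
  periodic-row T (nzr , _) i j = cong (λ k → entry T k _) (mod-+ i (rows T) {{nzr}})

  periodic-col : ∀ T ne i j → periodic T ne i (j ℕ.+ cols T) ≡ periodic T ne i j
  periodic-col T (_ , nzc) i j = cong (entry T _) (mod-+ j (cols T) {{nzc}})

  periodic-entry : ∀ T ne i j → periodic T ne (toℕ i) (toℕ j) ≡ entry T i j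
  periodic-entry T (nzr , nzc) i j = cong₂ (entry T) (mod-toℕ {{nzr}} i) (mod-toℕ {{nzc}} j)

  tile : (Sig → ℤ) → (T : Array Sig) → Nonempty T → Cell → ℤ
  tile w T ne = rectangle (rows T) (cols T) (λ i j → w (periodic T ne i j))

  quarterPlane : (Sig → ℤ) → (T : Array Sig) → Nonempty T → Cell → ℤ
  quarterPlane w T ne = quadrant (λ i j → w (periodic T ne i j))

  quarterPlane-InQuadrant : ∀ w T ne → InQuadrant (quarterPlane w T ne)
  quarterPlane-InQuadrant w T ne = quadrant-InQuadrant (λ i j → w (periodic T ne i j))

  tile-InQuadrant : ∀ w T ne → InQuadrant (tile w T ne)
  tile-InQuadrant w T ne = rectangle-InQuadrant (rows T) (cols T) (λ i j → w (periodic T ne i j))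

  corners-quarterPlane : ∀ w T ne c →
    act (corners (rows T) (cols T)) (quarterPlane w T ne) c ≡ tile w T ne c
  corners-quarterPlane w T ne = corners-quadrant (rows T) (cols T) _
    (λ i j → cong w (periodic-row T ne i j)) (λ i j → cong w (periodic-col T ne i j))

  -- With this weight `tile` is the indicator of the rectangle, and sums of translates count the
  -- tiles over a cell.
  one : Sig → ℤ
  one _ = 1ℤ

  tile-cases : ∀ T ne d c →
    (tile one T ne (c ⊖ d) ≡ 1ℤ × Occupies (T , d) c) ⊎
    (tile one T ne (c ⊖ d) ≡ 0ℤ × ¬ Occupies (T , d) c)
  tile-cases T ne (a , b) (x , y)
    with interval-cases (rows T) (x - a) | interval-cases (cols T) (y - b)
  ... | inj₁ (p , i , x-a≡i) | inj₁ (q , j , y-b≡j) =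
    inj₁ (cong₂ (λ u v → u * v * 1ℤ) p q , (i , j) , cong₂ _,_ (move x a x-a≡i) (move y b y-b≡j))
    where
    move : ∀ x a {z} → x - a ≡ z → x ≡ a + z
    move x a refl = sym (trans (ℤ.+-comm a (x - a)) (x-y+y≡x x a))
  ... | inj₂ (p , ∄i) | _ =
    inj₂ (cong (λ u → u * interval (cols T) (y - b) * 1ℤ) p ,
          λ { ((i , j) , refl) → ∄i (i , x+y-x≡y a _) })
  ... | inj₁ _ | inj₂ (q , ∄j) =
    inj₂ (trans (cong (λ v → interval (rows T) (x - a) * v * 1ℤ) q)
                (cong (_* 1ℤ) (ℤ.*-zeroʳ (interval (rows T) (x - a)))) ,
          λ { ((i , j) , refl) → ∄j (j , x+y-x≡y b _) })

  window : Array Sig → Cell → ℤ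
  window T (x , y) = interval (rows T) x * interval (cols T) y

  -- Off the tile both sides vanish, so `ℓ` has to match only at occupied cells; it will be the
  -- label of the figure.
  tile-label : ∀ w T ne d c ℓ → (∀ ij → OccAt (T , d) c ij → ℓ ≡ entry T (proj₁ ij) (proj₂ ij)) →
               tile w T ne (c ⊖ d) ≡ tile one T ne (c ⊖ d) * w ℓ
  tile-label w T ne d@(a , b) c@(x , y) ℓ lab with tile-cases T ne d c
  ... | inj₂ (t≡0 , _) =
    trans (cong (_* w (periodic T ne ∣ x - a ∣ ∣ y - b ∣))
                (trans (sym (ℤ.*-identityʳ (window T (c ⊖ d)))) t≡0))
          (cong (_* w ℓ) (sym t≡0))
  ... | inj₁ (t≡1 , (i , j) , refl) =
    cong₂ _*_ (sym (ℤ.*-identityʳ (window T (c ⊖ d)))) (cong w (begin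
      periodic T ne ∣ (a + + toℕ i) - a ∣ ∣ (b + + toℕ j) - b ∣
        ≡⟨ cong₂ (λ u v → periodic T ne ∣ u ∣ ∣ v ∣) (x+y-x≡y a _) (x+y-x≡y b _) ⟩
      periodic T ne (toℕ i) (toℕ j)
        ≡⟨ periodic-entry T ne i j ⟩
      entry T i j
        ≡⟨ sym (lab (i , j) refl) ⟩
      ℓ ∎))
    where open ≡-Reasoning

-- Tilings

placed : ℤ → List Cell → Poly
placed s = map (s ,_)

act-placed-neg : ∀ L g c → act (placed -1ℤ L) g c ≡ - act (placed 1ℤ L) g c
act-placed-neg []      g c = refl
act-placed-neg (d ∷ L) g c =
  trans (+-congˡ (-1ℤ * g (c ⊖ d)) (act-placed-neg L g c)) (lem (g (c ⊖ d)) _)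
  where
  lem : ∀ a p → -1ℤ * a + - p ≡ - (1ℤ * a + p)
  lem = solve-∀

act-placed-difference : ∀ L M g c →
  act (placed 1ℤ L ++ placed -1ℤ M) g c ≡ act (placed 1ℤ L) g c - act (placed 1ℤ M) g c
act-placed-difference L M g c =
  trans (act-++ (placed 1ℤ L) (placed -1ℤ M) g c) (+-congˡ (act (placed 1ℤ L) g c) (act-placed-neg M g c))

_≟ᶜ_ : (c d : Cell) → Dec (c ≡ d)
_≟ᶜ_ = ≡-dec ℤ._≟_ ℤ._≟_

⊖≡0⇒≡ : ∀ {c d} → c ⊖ d ≡ (0ℤ , 0ℤ) → c ≡ d
⊖≡0⇒≡ eq = cong₂ _,_ (ℤ.i-j≡0⇒i≡j _ _ (cong proj₁ eq)) (ℤ.i-j≡0⇒i≡j _ _ (cong proj₂ eq))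

-- The series 1: acting on it reads off the coefficients of a polynomial.
δ : Cell → ℤ
δ c with c ≟ᶜ (0ℤ , 0ℤ)
... | yes _ = 1ℤ
... | no  _ = 0ℤ

-- The coefficient at `c` counts the occurrences of `c` in `L`; all terms have coefficient 1, so
-- nothing cancels.
placed-δ : ∀ L c → (c ∈ L × ∃[ n ] act (placed 1ℤ L) δ c ≡ + suc n) ⊎
                   (¬ c ∈ L × act (placed 1ℤ L) δ c ≡ 0ℤ)
placed-δ [] c = inj₂ ((λ ()) , refl)
placed-δ (d ∷ L) c with (c ⊖ d) ≟ᶜ (0ℤ , 0ℤ) | placed-δ L c
... | yes eq | inj₁ (_ , n , p) = inj₁ (here (⊖≡0⇒≡ eq) , suc n , cong (λ z → 1ℤ + z) p)
... | yes eq | inj₂ (_ , p) = inj₁ (here (⊖≡0⇒≡ eq) , 0 , cong (λ z → 1ℤ + z) p)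
... | no neq | inj₁ (c∈L , n , p) = inj₁ (there c∈L , n , trans (ℤ.+-identityˡ _) p)
... | no neq | inj₂ (c∉L , p) = inj₂ (c∉ , trans (ℤ.+-identityˡ _) p)
  where
  c∉ : ¬ c ∈ d ∷ L
  c∉ (here refl)  = neq (cong₂ _,_ (ℤ.+-inverseʳ (proj₁ c)) (ℤ.+-inverseʳ (proj₂ c)))
  c∉ (there c∈L) = c∉L c∈L

null⇒same-∈ : ∀ L M → Null (placed 1ℤ L ++ placed -1ℤ M) → ∀ c → (c ∈ L → c ∈ M) × (c ∈ M → c ∈ L)
null⇒same-∈ L M null c
  with placed-δ L c | placed-δ M c
     | ℤ.i-j≡0⇒i≡j _ _ (trans (sym (act-placed-difference L M δ c)) (null δ c))
... | inj₁ (c∈L , _) | inj₁ (c∈M , _) | _ = (λ _ → c∈M) , (λ _ → c∈L)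
... | inj₂ (c∉L , _) | inj₂ (c∉M , _) | _ = ⊥-elim ∘ c∉L , ⊥-elim ∘ c∉M
... | inj₁ (_ , _ , p) | inj₂ (_ , q) | eq = contradiction (trans (sym p) (trans eq q)) λ ()
... | inj₂ (_ , p) | inj₁ (_ , _ , q) | eq = contradiction (trans (sym q) (trans (sym eq) p)) λ ()

module _ {Sig : Set} where

  Disjoint : List (PlacedTile Sig) → Set
  Disjoint U = (k l : Fin (length U)) → ¬ (k ≡ l) → (c : Cell) →
               Occupies (lookup U k) c → ¬ Occupies (lookup U l) c

  Covered : List (PlacedTile Sig) → Cell → Set
  Covered U c = ∃[ t ] (t ∈ U × Occupies t c)

  -- Disjointness excludes that both summands are 1. They are kept as variables `a` and `s` so that
  -- their equations can be matched with `refl`.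
  covering-∷ : ∀ T d U c {a s : ℤ} → Disjoint ((T , d) ∷ U) →
    (a ≡ 1ℤ × Occupies (T , d) c) ⊎ (a ≡ 0ℤ × ¬ Occupies (T , d) c) →
    (s ≡ 1ℤ × Covered U c) ⊎ (s ≡ 0ℤ × ¬ Covered U c) →
    (a + s ≡ 1ℤ × Covered ((T , d) ∷ U) c) ⊎ (a + s ≡ 0ℤ × ¬ Covered ((T , d) ∷ U) c)
  covering-∷ T d U c disj (inj₁ (_ , occ)) (inj₁ (_ , t , t∈U , occ′)) =
    contradiction (subst (λ t → Occupies t c) (lookup-index t∈U) occ′)
                  (disj zero (suc (Any.index t∈U)) (λ ()) c occ)
  covering-∷ T d U c disj (inj₁ (refl , occ)) (inj₂ (refl , _)) =
    inj₁ (refl , _ , here refl , occ)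
  covering-∷ T d U c disj (inj₂ (refl , _)) (inj₁ (refl , t , t∈U , occ)) =
    inj₁ (refl , t , there t∈U , occ)
  covering-∷ T d U c disj (inj₂ (refl , ¬occ)) (inj₂ (refl , ¬cov)) =
    inj₂ (refl , λ { (_ , here refl , occ) → ¬occ occ ; (t , there t∈U , occ) → ¬cov (t , t∈U , occ) })

-- From a polynomial relation between the tiles to equal extensions

module _ {Sig : Set} (A B : Array Sig) (neA : Nonempty A) (neB : Nonempty B) where

  quarterPlanes-agree : ∀ P Q →
    (∀ w c → act P (tile w A neA) c + act Q (tile w B neB) c ≡ 0ℤ) →
    (Null P × Null Q) ⊎ (∀ w c → quarterPlane w A neA c ≡ quarterPlane w B neB c)
  quarterPlanes-agree P Q relation = conclude (null⊎cancellable R)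
    where
    open ≡-Reasoning
    R S : Poly
    R = mul P (corners (rows A) (cols A))
    S = mul Q (corners (rows B) (cols B))

    act-R : ∀ w c → act R (quarterPlane w A neA) c ≡ act P (tile w A neA) c
    act-R w c = trans (act-mul P _ _ c) (act-cong P (corners-quarterPlane w A neA) c)

    act-S : ∀ w c → act S (quarterPlane w B neB) c ≡ act Q (tile w B neB) c
    act-S w c = trans (act-mul Q _ _ c) (act-cong Q (corners-quarterPlane w B neB) c)

    R+S : ∀ w c → act R (quarterPlane w A neA) c + act S (quarterPlane w B neB) c ≡ 0ℤ
    R+S w c = trans (cong₂ _+_ (act-R w c) (act-S w c)) (relation w c)

    -- For weight `one` the two quarter planes are the same series, with value 1 at the origin, so a
    -- cancellable `R ++ S` would give 1 = 0.
    R++S-null : Null (R ++ S)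
    R++S-null with null⊎cancellable (R ++ S)
    ... | inj₁ null   = null
    ... | inj₂ cancel = contradiction
      (cancel (quarterPlane one A neA) (quarterPlane-InQuadrant one A neA)
              (λ c → trans (act-++ R S _ c) (R+S one c)) (0ℤ , 0ℤ))
      λ ()

    S≡-R : ∀ g c → act S g c ≡ - act R g c
    S≡-R g c = begin
      act S g c                             ≡⟨ lem (act R g c) (act S g c) ⟩
      (act R g c + act S g c) - act R g c   ≡⟨ cong (_- act R g c) (sym (act-++ R S g c)) ⟩
      act (R ++ S) g c - act R g c          ≡⟨ cong (_- act R g c) (R++S-null g c) ⟩
      0ℤ - act R g c                        ≡⟨ ℤ.+-identityˡ _ ⟩
      - act R g c                           ∎
      where
      lem : ∀ a b → b ≡ (a + b) - a
      lem = solve-∀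

    R-difference : ∀ w c → act R (λ e → quarterPlane w A neA e - quarterPlane w B neB e) c ≡ 0ℤ
    R-difference w c = begin
      act R (λ e → quarterPlane w A neA e - quarterPlane w B neB e) c
        ≡⟨ act-- R _ _ c ⟩
      act R (quarterPlane w A neA) c - act R (quarterPlane w B neB) c
        ≡⟨ +-congˡ (act R (quarterPlane w A neA) c) (sym (S≡-R (quarterPlane w B neB) c)) ⟩
      act R (quarterPlane w A neA) c + act S (quarterPlane w B neB) c
        ≡⟨ R+S w c ⟩
      0ℤ ∎

    conclude : Null R ⊎ Cancellable R → _
    conclude (inj₂ cancel) = inj₂ λ w c → ℤ.i-j≡0⇒i≡j _ _
      (cancel _ (difference-InQuadrant (quarterPlane-InQuadrant w A neA) (quarterPlane-InQuadrant w B neB))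
              (R-difference w) c)
    conclude (inj₁ nullR) = inj₁
      ( null-factor P A neA (λ c → trans (sym (act-R one c)) (nullR _ c))
      , null-factor Q B neB (λ c → trans (sym (act-S one c))
          (trans (S≡-R _ c) (cong -_ (nullR _ c)))) )
      where
      tile-origin : ∀ T ne → tile one T ne (0ℤ , 0ℤ) ≡ 1ℤ
      tile-origin (mkArray (suc _) (suc _) _) _ = refl

      -- This replaces division by `corners`: the indicator of the tile lies in the quadrant and is
      -- 1 at the origin, so a polynomial annihilating it is not cancellable.
      null-factor : ∀ N T ne → (∀ c → act N (tile one T ne) c ≡ 0ℤ) → Null N
      null-factor N T ne N≡0 with null⊎cancellable N
      ... | inj₁ null   = null
      ... | inj₂ cancel = contradiction
        (trans (sym (tile-origin T ne)) (cancel _ (tile-InQuadrant one T ne) N≡0 (0ℤ , 0ℤ)))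
        λ ()

  -- Positions of the tiles and weighted covering counts

  FromPair : List (PlacedTile Sig) → Set
  FromPair = All (λ t → Pair A B (proj₁ t))

  -- The split follows the given evidence; if `A ≡ B`, two tilings may list the same tile under
  -- different arrays.
  positionsA positionsB : ∀ {U} → FromPair U → List Cell
  positionsA []                         = []
  positionsA (_∷_ {x = _ , d} (inj₁ _) p) = d ∷ positionsA p
  positionsA (inj₂ _ ∷ p)               = positionsA p
  positionsB []                         = []
  positionsB (inj₁ _ ∷ p)               = positionsB p
  positionsB (_∷_ {x = _ , d} (inj₂ _) p) = d ∷ positionsB p

  ∈-positions⁻ : ∀ {U} (p : FromPair U) {t} → t ∈ U →
    (proj₁ t ≡ A × proj₂ t ∈ positionsA p) ⊎ (proj₁ t ≡ B × proj₂ t ∈ positionsB p)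
  ∈-positions⁻ (inj₁ refl ∷ p) (here refl) = inj₁ (refl , here refl)
  ∈-positions⁻ (inj₂ refl ∷ p) (here refl) = inj₂ (refl , here refl)
  ∈-positions⁻ (inj₁ refl ∷ p) (there t∈U) with ∈-positions⁻ p t∈U
  ... | inj₁ (e , q) = inj₁ (e , there q)
  ... | inj₂ r       = inj₂ r
  ∈-positions⁻ (inj₂ refl ∷ p) (there t∈U) with ∈-positions⁻ p t∈U
  ... | inj₁ r       = inj₁ r
  ... | inj₂ (e , q) = inj₂ (e , there q)

  ∈-positionsA⁺ : ∀ {U} (p : FromPair U) {d} → d ∈ positionsA p → (A , d) ∈ U
  ∈-positionsA⁺ (inj₁ refl ∷ p) (here refl) = here refl
  ∈-positionsA⁺ (inj₁ refl ∷ p) (there d∈)  = there (∈-positionsA⁺ p d∈)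
  ∈-positionsA⁺ (inj₂ refl ∷ p) d∈          = there (∈-positionsA⁺ p d∈)

  ∈-positionsB⁺ : ∀ {U} (p : FromPair U) {d} → d ∈ positionsB p → (B , d) ∈ U
  ∈-positionsB⁺ (inj₂ refl ∷ p) (here refl) = here refl
  ∈-positionsB⁺ (inj₂ refl ∷ p) (there d∈)  = there (∈-positionsB⁺ p d∈)
  ∈-positionsB⁺ (inj₁ refl ∷ p) d∈          = there (∈-positionsB⁺ p d∈)

  positions-⊆ : ∀ {U V} (p : FromPair U) (q : FromPair V) →
    (∀ d → d ∈ positionsA p → d ∈ positionsA q) → (∀ d → d ∈ positionsB p → d ∈ positionsB q) →
    ∀ t → t ∈ U → t ∈ V
  positions-⊆ p q subA subB t t∈U with ∈-positions⁻ p t∈U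
  ... | inj₁ (refl , d∈) = ∈-positionsA⁺ q (subA _ d∈)
  ... | inj₂ (refl , d∈) = ∈-positionsB⁺ q (subB _ d∈)

  total : (Sig → ℤ) → ∀ {U} → FromPair U → Cell → ℤ
  total w []                           c = 0ℤ
  total w (_∷_ {x = _ , d} (inj₁ _) p) c = tile w A neA (c ⊖ d) + total w p c
  total w (_∷_ {x = _ , d} (inj₂ _) p) c = tile w B neB (c ⊖ d) + total w p c

  total-act : ∀ w {U} (p : FromPair U) c →
    act (placed 1ℤ (positionsA p)) (tile w A neA) c + act (placed 1ℤ (positionsB p)) (tile w B neB) c
    ≡ total w p c
  total-act w [] c = refl
  total-act w (_∷_ {x = _ , d} (inj₁ _) p) c =
    trans (lem (tile w A neA (c ⊖ d)) _ _) (+-congˡ (tile w A neA (c ⊖ d)) (total-act w p c))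
    where
    lem : ∀ a x y → (1ℤ * a + x) + y ≡ a + (x + y)
    lem = solve-∀
  total-act w (_∷_ {x = _ , d} (inj₂ _) p) c =
    trans (lem (tile w B neB (c ⊖ d)) (act (placed 1ℤ (positionsA p)) (tile w A neA) c) _)
          (+-congˡ (tile w B neB (c ⊖ d)) (total-act w p c))
    where
    lem : ∀ a x y → x + (1ℤ * a + y) ≡ a + (x + y)
    lem = solve-∀

  -- All tiles over `c` show the same letter `ℓ` there, so its weight factors out and a covering
  -- count remains.
  total-label : ∀ w {U} (p : FromPair U) c ℓ →
    (∀ t → t ∈ U → ∀ ij → OccAt t c ij → ℓ ≡ entry (proj₁ t) (proj₁ ij) (proj₂ ij)) →
    total w p c ≡ total one p c * w ℓ
  total-label w [] c ℓ lab = refl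
  total-label w (_∷_ {x = _ , d} (inj₁ refl) p) c ℓ lab =
    trans (cong₂ _+_ (tile-label w A neA d c ℓ (lab _ (here refl)))
                     (total-label w p c ℓ λ t t∈ → lab t (there t∈)))
          (sym (ℤ.*-distribʳ-+ (w ℓ) (tile one A neA (c ⊖ d)) (total one p c)))
  total-label w (_∷_ {x = _ , d} (inj₂ refl) p) c ℓ lab =
    trans (cong₂ _+_ (tile-label w B neB d c ℓ (lab _ (here refl)))
                     (total-label w p c ℓ λ t t∈ → lab t (there t∈)))
          (sym (ℤ.*-distribʳ-+ (w ℓ) (tile one B neB (c ⊖ d)) (total one p c)))

  total-one : ∀ {U} (p : FromPair U) → Disjoint U → ∀ c →
    (total one p c ≡ 1ℤ × Covered U c) ⊎ (total one p c ≡ 0ℤ × ¬ Covered U c)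
  total-one [] disj c = inj₂ (refl , λ ())
  total-one {(_ , d) ∷ U} (inj₁ refl ∷ p) disj c =
    covering-∷ A d U c disj (tile-cases A neA d c)
      (total-one p (λ k l k≢l → disj (suc k) (suc l) (k≢l ∘ Fin.suc-injective)) c)
  total-one {(_ , d) ∷ U} (inj₂ refl ∷ p) disj c =
    covering-∷ B d U c disj (tile-cases B neB d c)
      (total-one p (λ k l k≢l → disj (suc k) (suc l) (k≢l ∘ Fin.suc-injective)) c)

  -- Comparison of two tilings of one figure

  module _ {F : Figure Sig} {U V : List (PlacedTile Sig)}
           (tU : IsTiling F (Pair A B) U) (tV : IsTiling F (Pair A B) V) where
    private
      module U = IsTiling tU
      module V = IsTiling tV

    -- Either total is the weight of the label on the figure and zero elsewhere: a cell covered by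
    -- one tiling lies in the figure, hence is covered by the other.
    totals-agree : ∀ w c → total w U.fromS c ≡ total w V.fromS c
    totals-agree w c = trans (total-label w U.fromS c (label F c) λ t t∈ → U.labels t t∈ c)
      (trans (cong (_* w (label F c)) ones)
             (sym (total-label w V.fromS c (label F c) λ t t∈ → V.labels t t∈ c)))
      where
      ones : total one U.fromS c ≡ total one V.fromS c
      ones with total-one U.fromS U.disjoint c | total-one V.fromS V.disjoint c
      ... | inj₁ (p , _) | inj₁ (q , _) = trans p (sym q)
      ... | inj₂ (p , _) | inj₂ (q , _) = trans p (sym q)
      ... | inj₁ (_ , t , t∈ , occ) | inj₂ (_ , ¬cov) =
        contradiction (V.covers c (U.inside t t∈ c occ)) ¬cov
      ... | inj₂ (_ , ¬cov) | inj₁ (_ , t , t∈ , occ) =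
        contradiction (U.covers c (V.inside t t∈ c occ)) ¬cov

    same-or-agree : SameCollection U V ⊎ (∀ w c → quarterPlane w A neA c ≡ quarterPlane w B neB c)
    same-or-agree with quarterPlanes-agree
        (placed 1ℤ (positionsA U.fromS) ++ placed -1ℤ (positionsA V.fromS))
        (placed 1ℤ (positionsB U.fromS) ++ placed -1ℤ (positionsB V.fromS))
        relation
      where
      relation : ∀ w c → _ ≡ 0ℤ
      relation w c = trans
        (cong₂ _+_ (act-placed-difference (positionsA U.fromS) (positionsA V.fromS) (tile w A neA) c)
                   (act-placed-difference (positionsB U.fromS) (positionsB V.fromS) (tile w B neB) c))
        (trans (lem (act (placed 1ℤ (positionsA U.fromS)) (tile w A neA) c) _
                    (act (placed 1ℤ (positionsB U.fromS)) (tile w B neB) c) _)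
          (trans (cong₂ _-_ (total-act w U.fromS c) (total-act w V.fromS c))
                 (ℤ.i≡j⇒i-j≡0 (totals-agree w c))))
        where
        lem : ∀ a a′ b b′ → (a - a′) + (b - b′) ≡ (a + b) - (a′ + b′)
        lem = solve-∀
    ... | inj₂ agree = inj₂ agree
    ... | inj₁ (nullA , nullB) = inj₁ λ t → mk⇔
        (positions-⊆ U.fromS V.fromS (proj₁ ∘ sameA) (proj₁ ∘ sameB) t)
        (positions-⊆ V.fromS U.fromS (proj₂ ∘ sameA) (proj₂ ∘ sameB) t)
      where
      sameA = null⇒same-∈ (positionsA U.fromS) (positionsA V.fromS) nullA
      sameB = null⇒same-∈ (positionsB U.fromS) (positionsB V.fromS) nullB

-- Common periods

Period : ∀ {X : Set} → (ℕ → X) → ℕ → Set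
Period f p = ∀ i → f (i ℕ.+ p) ≡ f i

module _ {X : Set} {f : ℕ → X} where

  period-* : ∀ {p} → Period f p → ∀ k → Period f (k ℕ.* p)
  period-* {p} per zero    i = cong f (ℕ.+-identityʳ i)
  period-* {p} per (suc k) i =
    trans (cong f (sym (ℕ.+-assoc i p (k ℕ.* p)))) (trans (period-* per k (i ℕ.+ p)) (per i))

  -- A shift by `d` equals a shift by `d` followed by the harmless `p`, which together make `q`.
  period-∸ : ∀ {d p q} → Period f p → Period f q → d ℕ.+ p ≡ q → Period f d
  period-∸ {d} {p} perp perq refl i =
    trans (sym (perp (i ℕ.+ d))) (trans (cong f (ℕ.+-assoc i d p)) (perq i))

  -- Bézout over the naturals presents the gcd as a difference of a multiple of one number and a
  -- multiple of the other, in either order.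
  period-gcd : ∀ {p q} → Period f p → Period f q → Period f (gcd p q)
  period-gcd {p} {q} perp perq with Bézout.identity (gcd-GCD p q)
  ... | Bézout.+- x y eq = period-∸ (period-* perq y) (period-* perp x) eq
  ... | Bézout.-+ x y eq = period-∸ (period-* perp x) (period-* perq y) eq

  period-% : ∀ {p} .{{_ : NonZero p}} → Period f p → ∀ i → f (i % p) ≡ f i
  period-% {p} per i = trans (sym (period-* per (i / p) (i % p))) (cong f (sym (m≡m%n+[m/n]*n i p)))

positive-quotient : ∀ {n} q d → NonZero n → n ≡ q ℕ.* d → 1 ≤ q
positive-quotient zero    d nz refl = ⊥-elim (ℕ.≢-nonZero⁻¹ 0 {{nz}} refl)
positive-quotient (suc q) d nz _    = s≤s z≤n

-- The common root of two arrays with the same extension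

module _ {Sig : Set} where

  -- Comparing indices by their values in ℕ avoids transporting entries along the equalities of
  -- sizes.
  array-≡ : ∀ {m n m′ n′} {M : Vec.Vec (Vec.Vec Sig n) m} {M′ : Vec.Vec (Vec.Vec Sig n′) m′} →
    m ≡ m′ → n ≡ n′ →
    (∀ i j i′ j′ → toℕ i ≡ toℕ i′ → toℕ j ≡ toℕ j′ →
      Vec.lookup (Vec.lookup M i) j ≡ Vec.lookup (Vec.lookup M′ i′) j′) →
    mkArray m n M ≡ mkArray m′ n′ M′
  array-≡ {m} {n} refl refl eq =
    cong (mkArray m n) (lookup-ext λ i → lookup-ext λ j → eq i j i j refl refl)
    where
    lookup-ext : ∀ {X : Set} {k} {xs ys : Vec.Vec X k} →
                 (∀ i → Vec.lookup xs i ≡ Vec.lookup ys i) → xs ≡ ys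
    lookup-ext {xs = xs} {ys} eq =
      trans (sym (Vec.tabulate∘lookup xs)) (trans (Vec.tabulate-cong eq) (Vec.tabulate∘lookup ys))

  block : (f : ℕ → ℕ → Sig) (m n : ℕ) → Array Sig
  block f m n = mkArray m n (Vec.tabulate λ i → Vec.tabulate λ j → f (toℕ i) (toℕ j))

  lookup-tabulate² : ∀ {m n} (g : Fin m → Fin n → Sig) i j →
    Vec.lookup (Vec.lookup (Vec.tabulate λ i → Vec.tabulate λ j → g i j) i) j ≡ g i j
  lookup-tabulate² g i j =
    trans (cong (λ r → Vec.lookup r j) (Vec.lookup∘tabulate _ i)) (Vec.lookup∘tabulate _ j)

  -- `T` is the corner of its own extension `f`, and the periods of `f` allow both indices to be
  -- reduced modulo `m` and `n`, into the block.
  ≡-pow-block : ∀ T (neT : Nonempty T) {f : ℕ → ℕ → Sig} {m n} p q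
    (ne : Nonempty (block f m n)) →
    (∀ i j → f i j ≡ periodic T neT i j) →
    (∀ j → Period (λ i → f i j) m) → (∀ i → Period (f i) n) →
    rows T ≡ p ℕ.* m → cols T ≡ q ℕ.* n →
    T ≡ pow (block f m n) ne p q
  ≡-pow-block T neT {f} {m} {n} p q ne f≡T perˣ perʸ rows≡ cols≡ =
    array-≡ rows≡ cols≡ λ i j i′ j′ i≡i′ j≡j′ → begin
      entry T i j
        ≡⟨ sym (periodic-entry T neT i j) ⟩
      periodic T neT (toℕ i) (toℕ j)
        ≡⟨ sym (f≡T _ _) ⟩
      f (toℕ i) (toℕ j)
        ≡⟨ cong₂ f i≡i′ j≡j′ ⟩
      f (toℕ i′) (toℕ j′)
        ≡⟨ sym (trans (period-% (perˣ _) (toℕ i′)) (period-% (perʸ _) (toℕ j′))) ⟩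
      f (toℕ i′ % m) (toℕ j′ % n)
        ≡⟨ sym (cong₂ f (Fin.toℕ-fromℕ< _) (Fin.toℕ-fromℕ< _)) ⟩
      f (toℕ (toℕ i′ mod m)) (toℕ (toℕ j′ mod n))
        ≡⟨ sym (lookup-tabulate² (λ i j → f (toℕ i) (toℕ j)) (toℕ i′ mod m) (toℕ j′ mod n)) ⟩
      periodic (block f m n) ne (toℕ i′) (toℕ j′)
        ≡⟨ sym (lookup-tabulate² (λ i j → periodic (block f m n) ne (toℕ i) (toℕ j)) i′ j′) ⟩
      entry (pow (block f m n) ne p q) i′ j′ ∎
    where
    open ≡-Reasoning
    instance
      nzm : NonZero m
      nzm = proj₁ ne
      nzn : NonZero n
      nzn = proj₂ ne

  common-root : ∀ A B (neA : Nonempty A) (neB : Nonempty B) →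
    (∀ i j → periodic A neA i j ≡ periodic B neB i j) →
    Σ (Array Sig) λ C → Σ (Nonempty C) λ neC →
      ∃[ p₁ ] ∃[ q₁ ] ∃[ p₂ ] ∃[ q₂ ]
        (1 ≤ p₁ × 1 ≤ q₁ × 1 ≤ p₂ × 1 ≤ q₂ ×
         A ≡ pow C neC p₁ q₁ × B ≡ pow C neC p₂ q₂)
  common-root A B neA@(nzrA , nzcA) neB@(nzrB , nzcB) A≡B
    with gcd[m,n]∣m (rows A) (rows B) | gcd[m,n]∣m (cols A) (cols B)
       | gcd[m,n]∣n (rows A) (rows B) | gcd[m,n]∣n (cols A) (cols B)
  ... | divides p₁ e₁ | divides q₁ e₂ | divides p₂ e₃ | divides q₂ e₄ =
    block f m n , ne , p₁ , q₁ , p₂ , q₂ ,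
    positive-quotient p₁ m nzrA e₁ , positive-quotient q₁ n nzcA e₂ ,
    positive-quotient p₂ m nzrB e₃ , positive-quotient q₂ n nzcB e₄ ,
    ≡-pow-block A neA p₁ q₁ ne (λ _ _ → refl) perˣ perʸ e₁ e₂ ,
    ≡-pow-block B neB p₂ q₂ ne A≡B perˣ perʸ e₃ e₄
    where
    f : ℕ → ℕ → Sig
    f = periodic A neA
    m n : ℕ
    m = gcd (rows A) (rows B)
    n = gcd (cols A) (cols B)
    ne : Nonempty (block f m n)
    ne = ℕ.≢-nonZero (gcd[m,n]≢0 _ _ (inj₁ (ℕ.≢-nonZero⁻¹ _ {{nzrA}})))
       , ℕ.≢-nonZero (gcd[m,n]≢0 _ _ (inj₁ (ℕ.≢-nonZero⁻¹ _ {{nzcA}})))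
    -- The period from `B` is carried over to `f`, the extension of `A`, through `A≡B`.
    perˣ : ∀ j → Period (λ i → f i j) m
    perˣ j = period-gcd (λ i → periodic-row A neA i j)
      (λ i → trans (A≡B _ j) (trans (periodic-row B neB i j) (sym (A≡B i j))))
    perʸ : ∀ i → Period (f i) n
    perʸ i = period-gcd (λ j → periodic-col A neA i j)
      (λ j → trans (A≡B i _) (trans (periodic-col B neB i j) (sym (A≡B i j))))

theorem6 : (Sig : Set) → Finite Sig → (F : Figure Sig) → (A B : Array Sig) →
    Nonempty A → Nonempty B →
    (U V : List (PlacedTile Sig)) →
    IsTiling F (Pair A B) U → IsTiling F (Pair A B) V →
    ¬ SameCollection U V →
    Σ (Array Sig) λ C → Σ (Nonempty C) λ neC →
    ∃[ p₁ ] ∃[ q₁ ] ∃[ p₂ ] ∃[ q₂ ]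
    (1 ≤ p₁ × 1 ≤ q₁ × 1 ≤ p₂ × 1 ≤ q₂ ×
    A ≡ pow C neC p₁ q₁ × B ≡ pow C neC p₂ q₂)
theorem6 Sig (k , Sig↔Fin) F A B neA neB U V tU tV U≢V with same-or-agree A B neA neB tU tV
... | inj₁ same  = contradiction same U≢V
-- At natural coordinates both steps are 1, which leaves the codes of the two letters.
... | inj₂ agree = common-root A B neA neB λ i j → code-injective
  (trans (sym (ℤ.*-identityˡ _)) (trans (agree code (+ i , + j)) (ℤ.*-identityˡ _)))
  where
  -- Finiteness of the alphabet supplies an injective weight, so equal weights mean equal letters.
  code : Sig → ℤ
  code σ = + toℕ (Inverse.to Sig↔Fin σ)
  code-injective : ∀ {σ τ} → code σ ≡ code τ → σ ≡ τ
  code-injective {σ} {τ} eq = trans (sym (Inverse.strictlyInverseʳ Sig↔Fin σ))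
    (trans (cong (Inverse.from Sig↔Fin) (Fin.toℕ-injective (ℤ.+-injective eq)))
           (Inverse.strictlyInverseʳ Sig↔Fin τ))
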